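{- $\beta(3,13,4) = 7$.
   Context: For integers $v \ge k \ge 2$, a $(v,k)$-packing is a pair $(X,\mathcal{B})$ where $X$ is a set of $v$ points and $\mathcal{B}$ is a set of $k$-subsets of $X$ (blocks) such that every pair of distinct points lies in at most one block. A partial parallel class (PPC) is a set of pairwise disjoint blocks; its size is the number of blocks. A PPC of size $\rho$ is maximum if the packing has no PPC of size $\rho+1$. $\beta(\rho,v,k)$ denotes the maximum number of blocks in a $(v,k)$-packing in which the maximum PPC has size $\rho$. -}

module Defs where

open import Data.Fin.Base using (Fin)
open import Data.Fin.Subset using (Subset; Empty; _∩_; ∣_∣; _∈_)
open import Data.List.Base using (List; length)
import Data.List.Membership.Propositional as List
open import Data.List.Relation.Binary.Subset.Propositional using (_⊆_)
open import Data.List.Relation.Unary.All using (All)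
open import Data.List.Relation.Unary.AllPairs using (AllPairs)
open import Data.List.Relation.Unary.Unique.Propositional using (Unique)
open import Data.Nat.Base using (ℕ; suc; _≤_; _≥_)
open import Data.Nat.Properties using (≤-antisym)
open import Data.Product.Base using (_×_; _,_; ∃-syntax)
open import Relation.Binary.PropositionalEquality.Core using (_≡_; _≢_; refl)
open import Relation.Nullary.Negation.Core using (¬_)

-- A finite set of blocks is represented by a duplicate-free list, so that
-- its cardinality is the length of the list.

record Packing (v k : ℕ) : Set where
  field
    v≥k          : v ≥ k
    k≥2          : k ≥ 2
    blocks       : List (Subset v)
    unique       : Unique blocks
    uniform      : All (λ B → ∣ B ∣ ≡ k) blocks
    at-most-once : ∀ {x y : Fin v} → x ≢ y →
                   ∀ {B C} → B List.∈ blocks → C List.∈ blocks →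
                   x ∈ B → y ∈ B → x ∈ C → y ∈ C → B ≡ C

open Packing public

Disjoint : ∀ {n} → Subset n → Subset n → Set
Disjoint p q = Empty (p ∩ q)

record PPC {v k : ℕ} (𝓟 : Packing v k) (size : ℕ) : Set where
  field
    members  : List (Subset v)
    unique   : Unique members
    members⊆ : members ⊆ blocks 𝓟
    disjoint : AllPairs Disjoint members
    length≡  : length members ≡ size

MaximumPPCSize : ∀ {v k} → Packing v k → ℕ → Set
MaximumPPCSize 𝓟 ρ = PPC 𝓟 ρ × ¬ PPC 𝓟 (suc ρ)

#blocks : ∀ {v k} → Packing v k → ℕ
#blocks 𝓟 = length (blocks 𝓟)

-- β(ρ,v,k) is the maximum of a set of naturals which may be empty (there
-- need not be a suitable packing), so it is given by its graph:
-- β[ ρ , v , k ]≡ b says that the maximum exists and equals b.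

β[_,_,_]≡_ : (ρ v k b : ℕ) → Set
β[ ρ , v , k ]≡ b =
    (∃[ 𝓟 ] MaximumPPCSize {v} {k} 𝓟 ρ × #blocks 𝓟 ≡ b)
  × (∀ (𝓟 : Packing v k) → MaximumPPCSize 𝓟 ρ → #blocks 𝓟 ≤ b)

β-functional : ∀ {ρ v k b c} → β[ ρ , v , k ]≡ b → β[ ρ , v , k ]≡ c → b ≡ c
β-functional ((𝓟 , 𝓟-max , refl) , b-bound) ((𝓠 , 𝓠-max , refl) , c-bound) =
  ≤-antisym (c-bound 𝓟 𝓟-max) (b-bound 𝓠 𝓠-max)

{-# OPTIONS --safe #-}

-- Let A₁, A₂, A₃ be disjoint blocks.  They cover 12 of the 13 points, and any
-- other block meets each of them in at most one point; having 4 points, it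
-- meets each Aᵢ exactly once and contains the uncovered point.  Two such blocks
-- therefore coincide as soon as they meet A₁ in the same point, so there are at
-- most 4 of them, and 3 + 4 = 7.  Four disjoint transversals of the Aᵢ, each
-- extended by the uncovered point, attain the bound.

module Submission where

open import Defs
open import Data.Bool.Properties using () renaming (_≟_ to _≟ᵇ_)
open import Data.Fin.Base using (Fin; zero; suc)
open import Data.Fin.Properties using (injective⇒≤) renaming (_≟_ to _≟ᶠ_)
open import Data.Fin.Subset
  using (Subset; inside; outside; _∩_; _∪_; ∁; ⋃; ∣_∣; _∈_; Nonempty; ⊤; ⊥; ⁅_⁆)
open import Data.Fin.Subset.Properties
open import Data.List.Base using (List; []; _∷_; _++_; length; map; lookup; allFin)
open import Data.List.Membership.Propositional using () renaming (_∈_ to _∈ˡ_)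
open import Data.List.Membership.Propositional.Properties using (∈-map⁺; ∈-++⁺ˡ; ∈-++⁺ʳ; ∈-lookup)
open import Data.List.Properties using (length-map; length-++)
open import Data.List.Relation.Unary.All as All using (All; []; _∷_; all?)
open import Data.List.Relation.Unary.All.Properties as All
open import Data.List.Relation.Unary.AllPairs using (AllPairs; []; _∷_; allPairs?)
open import Data.List.Relation.Unary.Any using (here; there; index; any?)
open import Data.List.Relation.Unary.Any.Properties using (lookup-index)
open import Data.List.Relation.Unary.Unique.Propositional using (Unique)
open import Data.Nat.Base using (ℕ; zero; suc; _+_; _*_; _∸_; _≤_; z≤n; s≤s)
open import Data.Nat.ListAction using (sum)
open import Data.Nat.Properties
open import Data.Product.Base using (_×_; _,_; ∃-syntax; proj₁; proj₂)
open import Data.Sum.Base using (_⊎_; inj₁; inj₂)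
open import Data.Vec.Base using (here; there) renaming ([] to []ᵛ; _∷_ to _∷ᵛ_; _++_ to _++ᵛ_)
import Data.Vec.Properties as Vec
open import Function.Base using (_∘_)
open import Relation.Binary.Definitions using (DecidableEquality)
open import Relation.Binary.PropositionalEquality
open import Relation.Nullary using (¬_; yes; no; contradiction; ¬?)
open import Relation.Nullary.Decidable using (from-yes; _⊎-dec_)

private
  variable
    n : ℕ
    A B : Set

_≟ˢ_ : DecidableEquality (Subset n)
_≟ˢ_ = Vec.≡-dec _≟ᵇ_

-- Inclusion-exclusion in additive form, free of truncated subtraction; it yields both the union
-- bound and additivity over disjoint subsets.
∣p∪q∣+∣p∩q∣ : (p q : Subset n) → ∣ p ∪ q ∣ + ∣ p ∩ q ∣ ≡ ∣ p ∣ + ∣ q ∣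
∣p∪q∣+∣p∩q∣ []ᵛ            []ᵛ            = refl
∣p∪q∣+∣p∩q∣ (outside ∷ᵛ p) (outside ∷ᵛ q) = ∣p∪q∣+∣p∩q∣ p q
∣p∪q∣+∣p∩q∣ (inside  ∷ᵛ p) (outside ∷ᵛ q) = cong suc (∣p∪q∣+∣p∩q∣ p q)
∣p∪q∣+∣p∩q∣ (outside ∷ᵛ p) (inside  ∷ᵛ q) =
  trans (cong suc (∣p∪q∣+∣p∩q∣ p q)) (sym (+-suc _ _))
∣p∪q∣+∣p∩q∣ (inside  ∷ᵛ p) (inside  ∷ᵛ q) =
  cong suc (trans (+-suc _ _) (trans (cong suc (∣p∪q∣+∣p∩q∣ p q)) (sym (+-suc _ _))))

∣p∩q∣+∣p∩∁q∣ : (p q : Subset n) → ∣ p ∩ q ∣ + ∣ p ∩ ∁ q ∣ ≡ ∣ p ∣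
∣p∩q∣+∣p∩∁q∣ []ᵛ            []ᵛ            = refl
∣p∩q∣+∣p∩∁q∣ (outside ∷ᵛ p) (_       ∷ᵛ q) = ∣p∩q∣+∣p∩∁q∣ p q
∣p∩q∣+∣p∩∁q∣ (inside  ∷ᵛ p) (inside  ∷ᵛ q) = cong suc (∣p∩q∣+∣p∩∁q∣ p q)
∣p∩q∣+∣p∩∁q∣ (inside  ∷ᵛ p) (outside ∷ᵛ q) =
  trans (+-suc _ _) (cong suc (∣p∩q∣+∣p∩∁q∣ p q))

1≤∣p∣⇒Nonempty : (p : Subset n) → 1 ≤ ∣ p ∣ → Nonempty p
1≤∣p∣⇒Nonempty {n} p 1≤∣p∣ with nonempty? p
... | yes ne = ne
... | no  em =
  contradiction (trans (cong ∣_∣ (Empty-unique em)) (∣⊥∣≡0 n)) (≢-sym (<⇒≢ 1≤∣p∣))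

∣p∣≤1⇒x≡y : (p : Subset n) → ∣ p ∣ ≤ 1 → ∀ {x y} → x ∈ p → y ∈ p → x ≡ y
∣p∣≤1⇒x≡y (_ ∷ᵛ p)       _         here       here       = refl
-- A point of `p` makes `∣ p ∣` positive, because removing it lowers the cardinality.
∣p∣≤1⇒x≡y (inside ∷ᵛ p)  (s≤s ∣p∣≤0) here       (there y∈p) =
  contradiction (≤-<-trans z≤n (x∈p⇒∣p-x∣<∣p∣ y∈p)) (≤⇒≯ ∣p∣≤0)
∣p∣≤1⇒x≡y (inside ∷ᵛ p)  (s≤s ∣p∣≤0) (there x∈p) _          =
  contradiction (≤-<-trans z≤n (x∈p⇒∣p-x∣<∣p∣ x∈p)) (≤⇒≯ ∣p∣≤0)
∣p∣≤1⇒x≡y (outside ∷ᵛ p) ∣p∣≤1     (there x∈p) (there y∈p) =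
  cong suc (∣p∣≤1⇒x≡y p ∣p∣≤1 x∈p y∈p)

x≡y⇒∣p∣≤1 : (p : Subset n) → (∀ {x y} → x ∈ p → y ∈ p → x ≡ y) → ∣ p ∣ ≤ 1
x≡y⇒∣p∣≤1 {n} p eq with nonempty? p
... | no  em = ≤-trans (≤-reflexive (trans (cong ∣_∣ (Empty-unique em)) (∣⊥∣≡0 n))) z≤n
... | yes (x , x∈p) = subst (∣ p ∣ ≤_) (∣⁅x⁆∣≡1 x)
  (p⊆q⇒∣p∣≤∣q∣ λ y∈p → subst (_∈ ⁅ x ⁆) (eq x∈p y∈p) (x∈⁅x⁆ x))

elements : Subset n → List (Fin n)
elements []ᵛ            = []
elements (inside  ∷ᵛ p) = zero ∷ map suc (elements p)
elements (outside ∷ᵛ p) = map suc (elements p)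

length-elements : (p : Subset n) → length (elements p) ≡ ∣ p ∣
length-elements []ᵛ            = refl
length-elements (inside  ∷ᵛ p) = cong suc (trans (length-map suc (elements p)) (length-elements p))
length-elements (outside ∷ᵛ p) = trans (length-map suc (elements p)) (length-elements p)

∈-elements : {p : Subset n} {x : Fin n} → x ∈ p → x ∈ˡ elements p
∈-elements {p = _ ∷ᵛ _}       here        = here refl
∈-elements {p = inside ∷ᵛ _}  (there x∈p) = there (∈-map⁺ suc (∈-elements x∈p))
∈-elements {p = outside ∷ᵛ _} (there x∈p) = ∈-map⁺ suc (∈-elements x∈p)

∣p∩⋃∣≤sum : (p : Subset n) (qs : List (Subset n)) → ∣ p ∩ ⋃ qs ∣ ≤ sum (map (λ q → ∣ p ∩ q ∣) qs)
∣p∩⋃∣≤sum {n} p [] = ≤-trans (∣p∩q∣≤∣q∣ p ⊥) (≤-reflexive (∣⊥∣≡0 n))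
∣p∩⋃∣≤sum p (q ∷ qs) = begin
  ∣ p ∩ (q ∪ ⋃ qs) ∣                               ≡⟨ cong ∣_∣ (∩-distribˡ-∪ p q (⋃ qs)) ⟩
  ∣ p ∩ q ∪ p ∩ ⋃ qs ∣                             ≤⟨ m≤m+n _ _ ⟩
  ∣ p ∩ q ∪ p ∩ ⋃ qs ∣ + ∣ (p ∩ q) ∩ (p ∩ ⋃ qs) ∣  ≡⟨ ∣p∪q∣+∣p∩q∣ (p ∩ q) (p ∩ ⋃ qs) ⟩
  ∣ p ∩ q ∣ + ∣ p ∩ ⋃ qs ∣                         ≤⟨ +-monoʳ-≤ ∣ p ∩ q ∣ (∣p∩⋃∣≤sum p qs) ⟩
  ∣ p ∩ q ∣ + sum (map (λ q → ∣ p ∩ q ∣) qs)       ∎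
  where open ≤-Reasoning

Disjoint-⋃ : {p : Subset n} {qs : List (Subset n)} → All (Disjoint p) qs → Disjoint p (⋃ qs)
Disjoint-⋃ {p = p} {[]} [] (x , x∈) = ∉⊥ (proj₂ (x∈p∩q⁻ p ⊥ x∈))
Disjoint-⋃ {p = p} {q ∷ qs} (dis ∷ diss) (x , x∈) with x∈p∩q⁻ p (q ∪ ⋃ qs) x∈
... | x∈p , x∈∪ with x∈p∪q⁻ q (⋃ qs) x∈∪
... | inj₁ x∈q = dis (x , x∈p∩q⁺ (x∈p , x∈q))
... | inj₂ x∈⋃ = Disjoint-⋃ diss (x , x∈p∩q⁺ (x∈p , x∈⋃))

∣⋃∣-uniform : ∀ {k} {qs : List (Subset n)} → AllPairs Disjoint qs →
              All (λ q → ∣ q ∣ ≡ k) qs → ∣ ⋃ qs ∣ ≡ length qs * k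
∣⋃∣-uniform {n} [] [] = ∣⊥∣≡0 n
∣⋃∣-uniform {n} {k} {q ∷ qs} (dis ∷ diss) (∣q∣≡k ∷ sizes) = begin
  ∣ q ∪ ⋃ qs ∣                    ≡⟨ +-identityʳ _ ⟨
  ∣ q ∪ ⋃ qs ∣ + 0                ≡⟨ cong (∣ q ∪ ⋃ qs ∣ +_) ∣q∩⋃∣≡0 ⟨
  ∣ q ∪ ⋃ qs ∣ + ∣ q ∩ ⋃ qs ∣     ≡⟨ ∣p∪q∣+∣p∩q∣ q (⋃ qs) ⟩
  ∣ q ∣ + ∣ ⋃ qs ∣                ≡⟨ cong₂ _+_ ∣q∣≡k (∣⋃∣-uniform diss sizes) ⟩
  k + length qs * k               ∎
  where
  open ≡-Reasoning
  ∣q∩⋃∣≡0 : ∣ q ∩ ⋃ qs ∣ ≡ 0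
  ∣q∩⋃∣≡0 = trans (cong ∣_∣ (Empty-unique (Disjoint-⋃ dis))) (∣⊥∣≡0 n)

sum≤length : {xs : List ℕ} → All (_≤ 1) xs → sum xs ≤ length xs
sum≤length []       = z≤n
sum≤length (p ∷ ps) = +-mono-≤ p (sum≤length ps)

-- A zero entry would leave the whole sum to the tail, which contributes at most its own length, one
-- too little. This is how a tight count forces every trace of a block to be nonempty.
length≤sum⇒All-1≤ : {xs : List ℕ} → All (_≤ 1) xs → length xs ≤ sum xs → All (1 ≤_) xs
length≤sum⇒All-1≤ [] _ = []
length≤sum⇒All-1≤ {0 ∷ xs} (_ ∷ ps) le = contradiction (sum≤length ps) (<⇒≱ le)
length≤sum⇒All-1≤ {1 ∷ xs} (_ ∷ ps) (s≤s le) = s≤s z≤n ∷ length≤sum⇒All-1≤ ps le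
length≤sum⇒All-1≤ {suc (suc _) ∷ xs} (s≤s () ∷ ps) _

lookup-injective : {xs : List A} → Unique xs → ∀ {i j} → lookup xs i ≡ lookup xs j → i ≡ j
lookup-injective (_   ∷ _)    {zero}  {zero}  _  = refl
lookup-injective (x≢s ∷ _)    {zero}  {suc j} eq = contradiction eq (All.lookup x≢s (∈-lookup j))
lookup-injective (x≢s ∷ _)    {suc i} {zero}  eq = contradiction (sym eq) (All.lookup x≢s (∈-lookup i))
lookup-injective (_   ∷ uniq) {suc i} {suc j} eq = cong suc (lookup-injective uniq eq)

-- Sending each entry of `xs` to the position of its key in `ys` is injective, since a key
-- determines its entry.
length≤length-keys : (_~_ : A → B → Set) {xs : List A} {ys : List B} → Unique xs →
  (∀ {x} → x ∈ˡ xs → ∃[ y ] y ∈ˡ ys × x ~ y) →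
  (∀ {x x′ y} → x ∈ˡ xs → x′ ∈ˡ xs → x ~ y → x′ ~ y → x ≡ x′) →
  length xs ≤ length ys
length≤length-keys _~_ {xs} {ys} uniq key determined = injective⇒≤ {f = f} f-injective
  where
  f : Fin (length xs) → Fin (length ys)
  f i = index (proj₁ (proj₂ (key (∈-lookup i))))

  ~f : ∀ i → lookup xs i ~ lookup ys (f i)
  ~f i with key (∈-lookup {xs = xs} i)
  ... | y , y∈ys , x~y = subst (lookup xs i ~_) (lookup-index y∈ys) x~y

  f-injective : ∀ {i j} → f i ≡ f j → i ≡ j
  f-injective {i} {j} fi≡fj = lookup-injective uniq
    (determined (∈-lookup i) (∈-lookup j) (~f i)
      (subst (λ l → lookup xs j ~ lookup ys l) (sym fi≡fj) (~f j)))

-- The case `n` = 3 is the one wanted. The `n` members of the class serve as their own keys, and the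
-- `suc n` points of the first member `A` are the keys of all other blocks.
#blocks≤ : (𝓟 : Packing (suc (n * suc n)) (suc n)) → PPC 𝓟 n → #blocks 𝓟 ≤ n + suc n
-- Here `n` is 0 and blocks would have size 1, against `k≥2`; otherwise there is a first member to
-- take points from.
#blocks≤ 𝓟 record { members = [] ; length≡ = refl } =
  contradiction (k≥2 𝓟) λ { (s≤s ()) }
#blocks≤ {n} 𝓟 record
  { members = A ∷ As ; members⊆ = members⊆ ; disjoint = disjoint ; length≡ = length≡ } =
  ≤-trans (length≤length-keys _~_ (Packing.unique 𝓟) key determined) (≤-reflexive length-keys)
  where
  Point = Fin (suc (n * suc n))
  Block = Subset (suc (n * suc n))

  members = A ∷ As
  rest    = ∁ (⋃ members)

  size : ∀ {B} → B ∈ˡ blocks 𝓟 → ∣ B ∣ ≡ suc n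
  size = All.lookup (uniform 𝓟)

  ∣rest∣≤1 : ∣ rest ∣ ≤ 1
  ∣rest∣≤1 = ≤-reflexive (begin
    ∣ rest ∣                                    ≡⟨ ∣∁p∣≡n∸∣p∣ (⋃ members) ⟩
    suc (n * suc n) ∸ ∣ ⋃ members ∣             ≡⟨ cong (suc (n * suc n) ∸_) (∣⋃∣-uniform disjoint (All.tabulate (size ∘ members⊆))) ⟩
    suc (n * suc n) ∸ length members * suc n    ≡⟨ cong (λ l → suc (n * suc n) ∸ l * suc n) length≡ ⟩
    suc (n * suc n) ∸ n * suc n                 ≡⟨ m+n∸n≡m 1 (n * suc n) ⟩
    1                                           ∎)
    where open ≡-Reasoning

  ∣B∩C∣≤1 : ∀ {B C} → B ∈ˡ blocks 𝓟 → C ∈ˡ blocks 𝓟 → B ≢ C → ∣ B ∩ C ∣ ≤ 1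
  ∣B∩C∣≤1 {B} {C} B∈ C∈ B≢C = x≡y⇒∣p∣≤1 (B ∩ C) same
    where
    same : ∀ {x y} → x ∈ B ∩ C → y ∈ B ∩ C → x ≡ y
    same {x} {y} x∈ y∈ with x ≟ᶠ y
    ... | yes x≡y = x≡y
    ... | no  x≢y with x∈p∩q⁻ B C x∈ | x∈p∩q⁻ B C y∈
    ... | x∈B , x∈C | y∈B , y∈C = contradiction (at-most-once 𝓟 x≢y B∈ C∈ x∈B y∈B x∈C y∈C) B≢C

  -- The set `rest` and the `n` members partition the points into `suc n` parts, each sharing at
  -- most one point with `B`. As `B` has `suc n` points, it meets every part.
  meets-all : ∀ {B} → B ∈ˡ blocks 𝓟 → ¬ B ∈ˡ members →
              Nonempty (B ∩ rest) × Nonempty (B ∩ A)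
  meets-all {B} B∈ B∉ with length≤sum⇒All-1≤ traces≤1 length≤sum
    where
    traces = ∣ B ∩ rest ∣ ∷ map (λ C → ∣ B ∩ C ∣) members

    traces≤1 : All (_≤ 1) traces
    traces≤1 = ≤-trans (∣p∩q∣≤∣q∣ B rest) ∣rest∣≤1
             ∷ All.map⁺ (All.tabulate λ C∈ →
                 ∣B∩C∣≤1 B∈ (members⊆ C∈) λ { refl → B∉ C∈ })

    length≤sum : length traces ≤ sum traces
    length≤sum = begin
      length traces                           ≡⟨ cong suc (trans (length-map (λ C → ∣ B ∩ C ∣) members) length≡) ⟩
      suc n                                   ≡⟨ size B∈ ⟨
      ∣ B ∣                                   ≡⟨ ∣p∩q∣+∣p∩∁q∣ B (⋃ members) ⟨
      ∣ B ∩ ⋃ members ∣ + ∣ B ∩ rest ∣        ≡⟨ +-comm ∣ B ∩ ⋃ members ∣ _ ⟩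
      ∣ B ∩ rest ∣ + ∣ B ∩ ⋃ members ∣        ≤⟨ +-monoʳ-≤ ∣ B ∩ rest ∣ (∣p∩⋃∣≤sum B members) ⟩
      sum traces                              ∎
      where open ≤-Reasoning
  -- The traces on `rest` and on `A` head the list; these two suffice to pin down `B`.
  ... | r ∷ a ∷ _ = 1≤∣p∣⇒Nonempty (B ∩ rest) r , 1≤∣p∣⇒Nonempty (B ∩ A) a

  -- A point key also records that the block reaches `rest`: this supplies the second common point
  -- of two blocks with equal keys.
  _~_ : Block → Block ⊎ Point → Set
  B ~ inj₁ C = B ≡ C
  B ~ inj₂ x = x ∈ B × x ∈ A × Nonempty (B ∩ rest)

  keys : List (Block ⊎ Point)
  keys = map inj₁ members ++ map inj₂ (elements A)

  length-keys : length keys ≡ n + suc n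
  length-keys = trans (length-++ (map inj₁ members)) (cong₂ _+_
    (trans (length-map inj₁ members) length≡)
    (trans (length-map inj₂ (elements A)) (trans (length-elements A) (size (members⊆ (here refl))))))

  key : ∀ {B} → B ∈ˡ blocks 𝓟 → ∃[ y ] y ∈ˡ keys × B ~ y
  key {B} B∈ with any? (B ≟ˢ_) members
  ... | yes B∈members = inj₁ B , ∈-++⁺ˡ (∈-map⁺ inj₁ B∈members) , refl
  ... | no  B∉members with meets-all B∈ B∉members
  ... | meets-rest , x , x∈ with x∈p∩q⁻ B A x∈
  ... | x∈B , x∈A =
    inj₂ x , ∈-++⁺ʳ (map inj₁ members) (∈-map⁺ inj₂ (∈-elements x∈A)) , x∈B , x∈A , meets-rest

  determined : ∀ {B C y} → B ∈ˡ blocks 𝓟 → C ∈ˡ blocks 𝓟 → B ~ y → C ~ y → B ≡ C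
  determined {y = inj₁ _} _ _ B≡ C≡ = trans B≡ (sym C≡)
  determined {B} {C} {inj₂ x} B∈ C∈ (x∈B , x∈A , b , b∈) (x∈C , _ , c , c∈)
    with x∈p∩q⁻ B rest b∈ | x∈p∩q⁻ C rest c∈
  ... | b∈B , b∈rest | c∈C , c∈rest =
    -- As `rest` has at most one point, `c` is `b`, so both blocks contain the pair `x`, `b`. The
    -- two points differ because `A` covers `x` while `b` is uncovered.
    at-most-once 𝓟 x≢b B∈ C∈ x∈B b∈B x∈C (subst (_∈ C) (∣p∣≤1⇒x≡y rest ∣rest∣≤1 c∈rest b∈rest) c∈C)
    where
    x≢b : x ≢ b
    x≢b refl = x∈∁p⇒x∉p b∈rest (p⊆p∪q (⋃ As) x∈A)

PPC-size : ∀ {v k s} (𝓟 : Packing v k) → PPC 𝓟 s → s * k ≤ v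
PPC-size {v} {k} 𝓟 record
  { members = Bs ; members⊆ = members⊆ ; disjoint = disjoint ; length≡ = refl } =
  subst (_≤ v) (∣⋃∣-uniform disjoint (All.tabulate (All.lookup (uniform 𝓟) ∘ members⊆))) (∣p∣≤n (⋃ Bs))

-- The points 0 to 11 in three consecutive quadruples; point 12 stays uncovered.
groups : List (Subset 13)
groups = (⊤ {4} ++ᵛ ⊥ {9}) ∷ (⊥ {4} ++ᵛ ⊤ {4} ++ᵛ ⊥ {5}) ∷ (⊥ {8} ++ᵛ ⊤ {4} ++ᵛ ⊥ {1}) ∷ []

-- The final `⊤ {1}` adjoins point 12, the only point that two of these blocks share; each meets
-- every group just once.
transversals : List (Subset 13)
transversals = map (λ i → ⁅ i ⁆ ++ᵛ ⁅ i ⁆ ++ᵛ ⁅ i ⁆ ++ᵛ ⊤ {1}) (allFin 4)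

extremal : Packing 13 4
extremal = record
  { v≥k          = from-yes (4 ≤? 13)
  ; k≥2          = from-yes (2 ≤? 4)
  ; blocks       = Bs
  ; unique       = from-yes (allPairs? (λ B C → ¬? (B ≟ˢ C)) Bs)
  ; uniform      = from-yes (all? (λ B → ∣ B ∣ ≟ 4) Bs)
  ; at-most-once = λ x≢y B∈ C∈ x∈B y∈B x∈C y∈C →
      linear x≢y (All.lookup (All.lookup meet≤1 B∈) C∈) (x∈p∩q⁺ (x∈B , x∈C)) (x∈p∩q⁺ (y∈B , y∈C))
  }
  where
  Bs : List (Subset 13)
  Bs = groups ++ transversals

  -- A decidable form of `at-most-once`, settled by evaluation over all pairs of blocks; `linear`
  -- translates it back to points.
  meet≤1 : All (λ B → All (λ C → B ≡ C ⊎ ∣ B ∩ C ∣ ≤ 1) Bs) Bs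
  meet≤1 = from-yes (all? (λ B → all? (λ C → (B ≟ˢ C) ⊎-dec (∣ B ∩ C ∣ ≤? 1)) Bs) Bs)

  linear : ∀ {x y} {B C : Subset 13} → x ≢ y → B ≡ C ⊎ ∣ B ∩ C ∣ ≤ 1 →
           x ∈ B ∩ C → y ∈ B ∩ C → B ≡ C
  linear _ (inj₁ B≡C) _ _ = B≡C
  linear {B = B} {C} x≢y (inj₂ le) x∈ y∈ = contradiction (∣p∣≤1⇒x≡y (B ∩ C) le x∈ y∈) x≢y

groups-PPC : PPC extremal 3
groups-PPC = record
  { members  = groups
  ; unique   = from-yes (allPairs? (λ B C → ¬? (B ≟ˢ C)) groups)
  ; members⊆ = ∈-++⁺ˡ
  ; disjoint = from-yes (allPairs? (λ B C → ¬? (nonempty? (B ∩ C))) groups)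
  ; length≡  = refl
  }

theorem4p8 : β[ 3 , 13 , 4 ]≡ 7
theorem4p8 =
  -- Four disjoint blocks would cover 16 of the 13 points.
  (extremal , (groups-PPC , λ ppc → contradiction (PPC-size extremal ppc) (from-yes (¬? (16 ≤? 13)))) , refl) ,
  -- With `n` = 3, the numbers of points and keys compute to 1 + 3 * 4 = 13 and 3 + 4 = 7.
  λ 𝓟 (ppc , _) → #blocks≤ 𝓟 ppc
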